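{- The partially ordered set $(\mathcal{C}_{m,n},\le)$ is a lattice.
   Context: $\mathcal{C}_{m,n}$ is the set of all convex $m\times n$ $(0,1)$-matrices (matrices in which the 1's in every row and every column occur consecutively), and $\le$ is the entrywise partial order. -}

module Defs where

open import Data.Bool using (Bool; true)
import Data.Bool as Bool
open import Data.Fin using (Fin; _≤_)
open import Data.Nat using (ℕ)
open import Data.Product using (_×_)
open import Data.Vec.Functional using (Vector; transpose)
open import Relation.Binary.PropositionalEquality using (_≡_)

-- (0,1)-matrices, with true for the entry 1 and false for the entry 0.
Matrix₀₁ : ℕ → ℕ → Set
Matrix₀₁ m n = Vector (Vector Bool n) m

-- The positions of the 1's form a (possibly empty) interval.
Consecutive : ∀ {n} → Vector Bool n → Set
Consecutive {n} v = ∀ (i j k : Fin n) → i ≤ j → j ≤ k → v i ≡ true → v k ≡ true → v j ≡ true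

Convex : ∀ {m n} → Matrix₀₁ m n → Set
Convex {m} {n} A = (∀ (i : Fin m) → Consecutive (A i)) × (∀ (j : Fin n) → Consecutive (transpose A j))

record 𝓒 (m n : ℕ) : Set where
  constructor mk𝓒
  field
    matrix : Matrix₀₁ m n
    convex : Convex matrix

open 𝓒 public

-- Equality of the underlying matrices: the convexity proof is irrelevant,
-- and matrices are equal when all their entries are.
_≈𝓒_ : ∀ {m n} → 𝓒 m n → 𝓒 m n → Set
A ≈𝓒 B = ∀ i j → matrix A i j ≡ matrix B i j

-- Entrywise order; Bool._≤_ is the order with false below true.
_≤𝓒_ : ∀ {m n} → 𝓒 m n → 𝓒 m n → Set
A ≤𝓒 B = ∀ i j → matrix A i j Bool.≤ matrix B i j

{-# OPTIONS --safe #-}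
-- Convexity is preserved by entrywise intersection, which gives the meet. The
-- join of A and B is the convex hull of A ∨ B, i.e. the intersection of all
-- convex matrices above it; membership in the hull is decidable because there
-- are only finitely many (0,1)-matrices of a given size.
module Submission where

open import Algebra.Core using (Op₂)
open import Data.Bool using (Bool; true; false; not; _∧_; _∨_; b≤b)
import Data.Bool as Bool
import Data.Bool.Properties as Boolₚ
open import Data.Fin using (Fin; combine; remQuot)
import Data.Fin as Fin
open import Data.Fin.Properties using (all?; remQuot-combine)
open import Data.Fin.Subset using (Subset)
open import Data.Fin.Subset.Properties using (anySubset?)
open import Data.Nat using (ℕ; _*_)
open import Data.Product using (Σ-syntax; ∃; _×_; _,_; uncurry)
open import Data.Vec using (lookup; tabulate)
open import Data.Vec.Functional using (Vector; transpose)
open import Data.Vec.Properties using (lookup∘tabulate)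
open import Relation.Binary.Lattice.Definitions using (Infimum; Supremum)
open import Relation.Binary.Lattice.Structures using (IsLattice)
open import Relation.Binary.PropositionalEquality using (_≡_; refl; sym; trans; cong; cong₂)
open import Relation.Binary.Structures using (IsPartialOrder)
open import Relation.Nullary using (Dec; contradiction)
open import Relation.Nullary.Decidable using (does; dec-true; dec-false; _×-dec_; _→-dec_)
open import Defs

private
  variable
    m n : ℕ

true⇒true⇒≤ : ∀ {x y} → (x ≡ true → y ≡ true) → x Bool.≤ y
true⇒true⇒≤ {false} {y} _ = Boolₚ.≤-minimum y
true⇒true⇒≤ {true}      f = Boolₚ.≤-reflexive (sym (f refl))

≤⇒true⇒true : ∀ {x y} → x Bool.≤ y → x ≡ true → y ≡ true
-- Only `b≤b` remains: the strict case of the order has `x` equal to `false`, contradicting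
-- `x ≡ true`.
≤⇒true⇒true b≤b x≡true = x≡true

∧-infimum : Infimum Bool._≤_ _∧_
∧-infimum false y = b≤b , Boolₚ.≤-minimum y , λ _ z≤x _ → z≤x
∧-infimum true  y = Boolₚ.≤-maximum y , b≤b , λ _ _ z≤y → z≤y

∨-supremum : Supremum Bool._≤_ _∨_
∨-supremum false y = Boolₚ.≤-minimum y , b≤b , λ _ _ y≤z → y≤z
∨-supremum true  y = b≤b , Boolₚ.≤-maximum y , λ _ x≤z _ → x≤z

infix 4 _≤ᴹ_

_≤ᴹ_ : Matrix₀₁ m n → Matrix₀₁ m n → Set
A ≤ᴹ B = ∀ i j → A i j Bool.≤ B i j

≤𝓒-isPartialOrder : IsPartialOrder (_≈𝓒_ {m} {n}) _≤𝓒_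
≤𝓒-isPartialOrder = record
  { isPreorder = record
    { isEquivalence = record
      { refl  = λ _ _ → refl
      ; sym   = λ A≈B i j → sym (A≈B i j)
      ; trans = λ A≈B B≈C i j → trans (A≈B i j) (B≈C i j)
      }
    ; reflexive = λ A≈B i j → Boolₚ.≤-reflexive (A≈B i j)
    ; trans     = λ A≤B B≤C i j → Boolₚ.≤-trans (A≤B i j) (B≤C i j)
    }
  ; antisym = λ A≤B B≤A i j → Boolₚ.≤-antisym (A≤B i j) (B≤A i j)
  }

Consecutive-∧ : {v w : Vector Bool n} → Consecutive v → Consecutive w →
                Consecutive (λ i → v i ∧ w i)
Consecutive-∧ {v = v} {w} cv cw i j k i≤j j≤k pi pk = cong₂ _∧_
  (cv i j k i≤j j≤k (Boolₚ.∧-conicalˡ (v i) (w i) pi) (Boolₚ.∧-conicalˡ (v k) (w k) pk))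
  (cw i j k i≤j j≤k (Boolₚ.∧-conicalʳ (v i) (w i) pi) (Boolₚ.∧-conicalʳ (v k) (w k) pk))

_⊓_ : Op₂ (𝓒 m n)
mk𝓒 A (rowsA , colsA) ⊓ mk𝓒 B (rowsB , colsB) = mk𝓒 (λ i j → A i j ∧ B i j)
  ((λ i → Consecutive-∧ (rowsA i) (rowsB i)) , (λ j → Consecutive-∧ (colsA j) (colsB j)))

⊓-infimum : Infimum (_≤𝓒_ {m} {n}) _⊓_
⊓-infimum A B =
    (λ i j → let (∧≤a , _ , _) = ∧-infimum (matrix A i j) (matrix B i j) in ∧≤a)
  , (λ i j → let (_ , ∧≤b , _) = ∧-infimum (matrix A i j) (matrix B i j) in ∧≤b)
  , (λ C C≤A C≤B i j →
      let (_ , _ , greatest) = ∧-infimum (matrix A i j) (matrix B i j)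
      in greatest (matrix C i j) (C≤A i j) (C≤B i j))

consecutive? : (v : Vector Bool n) → Dec (Consecutive v)
consecutive? v = all? λ i → all? λ j → all? λ k →
  (i Fin.≤? j) →-dec ((j Fin.≤? k) →-dec
  ((v i Bool.≟ true) →-dec ((v k Bool.≟ true) →-dec (v j Bool.≟ true))))

convex? : (A : Matrix₀₁ m n) → Dec (Convex A)
convex? A = all? (λ i → consecutive? (A i)) ×-dec all? (λ j → consecutive? (transpose A j))

Consecutive-resp : {v w : Vector Bool n} → (∀ i → v i ≡ w i) → Consecutive v → Consecutive w
Consecutive-resp v≗w cv i j k i≤j j≤k wi wk = trans (sym (v≗w j))
  (cv i j k i≤j j≤k (trans (v≗w i) wi) (trans (v≗w k) wk))

-- Needed because decoding an encoded matrix recovers it only entry by entry, so convexity has to be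
-- transported along pointwise equality.
Convex-resp : {A B : Matrix₀₁ m n} → (∀ i j → A i j ≡ B i j) → Convex A → Convex B
Convex-resp A≗B (rows , cols) =
  (λ i → Consecutive-resp (A≗B i) (rows i)) , (λ j → Consecutive-resp (λ i → A≗B i j) (cols j))

-- Without function extensionality matrices cannot be enumerated up to _≡_, so
-- quantification over them goes through subsets of the m * n positions.
decode : Subset (m * n) → Matrix₀₁ m n
decode S i j = lookup S (combine i j)

encode : Matrix₀₁ m n → Subset (m * n)
encode {n = n} A = tabulate (λ p → uncurry A (remQuot n p))

decode∘encode : (A : Matrix₀₁ m n) → ∀ i j → decode (encode A) i j ≡ A i j
decode∘encode A i j = trans (lookup∘tabulate _ (combine i j)) (cong (uncurry A) (remQuot-combine i j))

-- A certificate that position `(i , j)` lies outside the convex hull of `U`.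
Excludes : Matrix₀₁ m n → Fin m → Fin n → Matrix₀₁ m n → Set
Excludes U i j C = Convex C × U ≤ᴹ C × C i j ≡ false

excludes? : (U : Matrix₀₁ m n) → ∀ i j (C : Matrix₀₁ m n) → Dec (Excludes U i j C)
excludes? U i j C =
  convex? C ×-dec all? (λ k → all? λ l → U k l Bool.≤? C k l) ×-dec (C i j Bool.≟ false)

excluded? : (U : Matrix₀₁ m n) → ∀ i j → Dec (∃ λ S → Excludes U i j (decode S))
excluded? U i j = anySubset? (λ S → excludes? U i j (decode S))

-- The intersection of all convex matrices above `U`, read contrapositively: an entry is 1 when the
-- finite search finds no matrix excluding it.
hull : Matrix₀₁ m n → Matrix₀₁ m n
hull U i j = not (does (excluded? U i j))

-- Where `C` has a 0, `C` itself, passed through `encode`, is a certificate of exclusion, so the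
-- hull has a 0 there too.
hull-least : (U C : Matrix₀₁ m n) → Convex C → U ≤ᴹ C → hull U ≤ᴹ C
hull-least U C convexC U≤C i j with C i j in Cij
... | true  = Boolₚ.≤-maximum _
... | false = Boolₚ.≤-reflexive (cong not (dec-true (excluded? U i j)
  ( encode C
  , Convex-resp (λ k l → sym (decode∘encode C k l)) convexC
  , (λ k l → Boolₚ.≤-trans (U≤C k l) (Boolₚ.≤-reflexive (sym (decode∘encode C k l))))
  , trans (decode∘encode C i j) Cij
  )))

-- Any certificate found by the search decodes to a convex matrix above `U` with a 0 at `(i , j)`,
-- against the assumption.
∈-hull : (U : Matrix₀₁ m n) → ∀ i j →
         (∀ C → Convex C → U ≤ᴹ C → C i j ≡ true) → hull U i j ≡ true
∈-hull U i j inAll = cong not (dec-false (excluded? U i j)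
  λ (S , convexS , U≤S , Sij≡false) →
    contradiction (trans (sym Sij≡false) (inAll (decode S) convexS U≤S)) λ ())

hull-extensive : (U : Matrix₀₁ m n) → U ≤ᴹ hull U
hull-extensive U i j = true⇒true⇒≤ λ Uij →
  ∈-hull U i j λ _ _ U≤C → ≤⇒true⇒true (U≤C i j) Uij

-- Convexity survives arbitrary intersections: two 1's of the hull in a line are 1's of every convex
-- `C` above `U`, by `hull-least`, so each such `C` has 1's between them, and hence so does the
-- hull.
hull-convex : (U : Matrix₀₁ m n) → Convex (hull U)
hull-convex U =
    (λ r i j k i≤j j≤k ri rk → ∈-hull U r j λ C cC@(rows , _) U≤C →
      rows r i j k i≤j j≤k
        (≤⇒true⇒true (hull-least U C cC U≤C r i) ri)
        (≤⇒true⇒true (hull-least U C cC U≤C r k) rk))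
  , (λ c i j k i≤j j≤k ic kc → ∈-hull U j c λ C cC@(_ , cols) U≤C →
      cols c i j k i≤j j≤k
        (≤⇒true⇒true (hull-least U C cC U≤C i c) ic)
        (≤⇒true⇒true (hull-least U C cC U≤C k c) kc))

_∨ᴹ_ : Op₂ (Matrix₀₁ m n)
(A ∨ᴹ B) i j = A i j ∨ B i j

-- The hull cannot be dropped: the rows 100 and 001 are convex, but their disjunction 101 is not.
_⊔_ : Op₂ (𝓒 m n)
A ⊔ B = mk𝓒 (hull (matrix A ∨ᴹ matrix B)) (hull-convex (matrix A ∨ᴹ matrix B))

⊔-supremum : Supremum (_≤𝓒_ {m} {n}) _⊔_
⊔-supremum A B =
    (λ i j → let (a≤∨ , _ , _) = ∨-supremum (matrix A i j) (matrix B i j)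
             in Boolₚ.≤-trans a≤∨ (hull-extensive (matrix A ∨ᴹ matrix B) i j))
  , (λ i j → let (_ , b≤∨ , _) = ∨-supremum (matrix A i j) (matrix B i j)
             in Boolₚ.≤-trans b≤∨ (hull-extensive (matrix A ∨ᴹ matrix B) i j))
  -- A common upper bound lies above the entrywise disjunction and is convex, hence lies above the
  -- hull.
  , (λ C A≤C B≤C → hull-least (matrix A ∨ᴹ matrix B) (matrix C) (convex C) λ i j →
      let (_ , _ , least) = ∨-supremum (matrix A i j) (matrix B i j)
      in least (matrix C i j) (A≤C i j) (B≤C i j))

mainTheorem12 : ∀ (m n : ℕ) →
    Σ[ join ∈ Op₂ (𝓒 m n) ] Σ[ meet ∈ Op₂ (𝓒 m n) ]
    IsLattice _≈𝓒_ _≤𝓒_ join meet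
mainTheorem12 m n = _⊔_ , _⊓_ , record
  { isPartialOrder = ≤𝓒-isPartialOrder
  ; supremum       = ⊔-supremum
  ; infimum        = ⊓-infimum
  }
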